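{- Let $G$ be a minimal $(3,3)$-Ramsey graph with $\omega(G) \leq 4$. Then $\delta(G) \geq 5$. Moreover, if $v \in V(G)$ and $d(v) = 5$, then $G(v)$ is isomorphic to $N_{5.i}$ for some $i \in \{1,2,3\}$.
   Context: All graphs are finite, undirected, without loops or multiple edges. $\omega(G)$ is the clique number, $\delta(G)$ the minimum degree, $d(v)$ the degree of $v$, and $G(v)$ the subgraph of $G$ induced by the set of neighbors of $v$. A graph $G$ is a $(3,3)$-Ramsey graph, written $G \rightarrow (3,3)$, if every coloring of the edges of $G$ with two colors contains a monochromatic triangle. $G$ is a minimal $(3,3)$-Ramsey graph if $G \rightarrow (3,3)$ and no proper subgraph $H$ of $G$ satisfies $H \rightarrow (3,3)$. For vertex-disjoint graphs $G_1,G_2$, $G_1+G_2$ denotes their join (all edges between $G_1$ and $G_2$ are added). The 5-vertex graphs are $N_{5.1} = K_1 + 2K_2$ (two triangles sharing exactly one vertex), $N_{5.2} = K_1 + P_4$ with $P_4$ the path on $4$ vertices, and $N_{5.3} = K_1 + C_4$ with $C_4$ the cycle on $4$ vertices. -}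

module Defs where

open import Data.Bool using (Bool; true; false; T)
open import Data.Bool.Properties using (T?)
open import Data.Fin using (Fin; zero; toℕ; fromℕ; splitAt; _≟_)
open import Data.Fin.Properties using (all?)
open import Data.Fin.Subset using (Subset; _∈_; _⊆_; _∩_; ∣_∣; ⊤)
open import Data.Fin.Subset.Properties using (_∈?_; _⊆?_; ∈⊤; x∈p∩q⁺; anySubset?)
open import Data.List using (map; filter; allFin; upTo)
open import Data.List.Extrema.Nat using (min; max)
open import Data.Nat as ℕ using (ℕ)
open import Data.Nat.Properties using (1+n≢n)
open import Data.Product using (Σ; ∃; _×_; _,_; proj₁)
open import Data.Sum using (_⊎_; inj₁; inj₂; [_,_]′; swap)
open import Data.Vec using (tabulate; lookup; _++_)
open import Data.Vec.Properties using ([]=⇒lookup; lookup⇒[]=; lookup-splitAt)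
open import Function using (_↔_; _⇔_; Inverse)
open import Relation.Binary using (Rel; Symmetric; Irreflexive; Decidable)
open import Relation.Binary.PropositionalEquality using (_≡_; _≢_; refl; sym; trans)
open import Relation.Nullary using (¬_; Dec; does; ¬?)
open import Relation.Nullary.Decidable using (_×-dec_; _⊎-dec_; _→-dec_)
open import Level using (0ℓ)

-- A finite simple graph whose vertices form an arbitrary subset of Fin n, so
-- that subgraphs and induced subgraphs of a graph live over the same Fin n.
record Graph (n : ℕ) : Set₁ where
  field
    V      : Subset n
    Adj    : Rel (Fin n) 0ℓ
    adj?   : Decidable Adj
    symm   : Symmetric Adj
    irrefl : Irreflexive _≡_ Adj
    inV    : ∀ {x y} → Adj x y → x ∈ V

open Graph public

Vertex : ∀ {n} → Graph n → Set
Vertex {n} G = Σ (Fin n) (_∈ V G)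

infix 4 _≅_
_≅_ : ∀ {m n} → Graph m → Graph n → Set
G ≅ H = Σ (Vertex G ↔ Vertex H) λ f → let open Inverse f in
  ∀ u w → Adj G (proj₁ u) (proj₁ w) ⇔ Adj H (proj₁ (to u)) (proj₁ (to w))

infix 4 _⊑_ _⊏_
_⊑_ : ∀ {n} → Graph n → Graph n → Set
H ⊑ G = V H ⊆ V G × (∀ {x y} → Adj H x y → Adj G x y)

_⊏_ : ∀ {n} → Graph n → Graph n → Set
H ⊏ G = H ⊑ G × ¬ (G ⊑ H)

induced : ∀ {n} → Graph n → Subset n → Graph n
induced G p = record
  { V      = V G ∩ p
  ; Adj    = λ x y → Adj G x y × x ∈ p × y ∈ p
  ; adj?   = λ x y → adj? G x y ×-dec ((x ∈? p) ×-dec (y ∈? p))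
  ; symm   = λ (a , x∈p , y∈p) → symm G a , y∈p , x∈p
  ; irrefl = λ eq (a , _) → irrefl G eq a
  ; inV    = λ (a , x∈p , _) → x∈p∩q⁺ (inV G a , x∈p)
  }

N : ∀ {n} → Graph n → Fin n → Subset n
N G v = tabulate (λ u → does (adj? G v u))

d : ∀ {n} → Graph n → Fin n → ℕ
d G v = ∣ N G v ∣

infix 8 _⟨_⟩
_⟨_⟩ : ∀ {n} → Graph n → Fin n → Graph n
G ⟨ v ⟩ = induced G (N G v)

-- The default value n exceeds every degree, so it is only attained by the
-- graph with no vertices, which has no minimum degree.
δ : ∀ {n} → Graph n → ℕ
δ {n} G = min n (map (d G) (filter (_∈? V G) (allFin n)))

IsClique : ∀ {n} → Graph n → Subset n → Set
IsClique G p = p ⊆ V G × (∀ x y → x ∈ p → y ∈ p → x ≢ y → Adj G x y)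

isClique? : ∀ {n} (G : Graph n) (p : Subset n) → Dec (IsClique G p)
isClique? G p = (p ⊆? V G) ×-dec
  all? λ x → all? λ y →
    (x ∈? p) →-dec ((y ∈? p) →-dec (¬? (x ≟ y) →-dec adj? G x y))

HasCliqueOfSize : ∀ {n} → Graph n → ℕ → Set
HasCliqueOfSize G k = ∃ λ p → IsClique G p × ∣ p ∣ ≡ k

hasCliqueOfSize? : ∀ {n} (G : Graph n) (k : ℕ) → Dec (HasCliqueOfSize G k)
hasCliqueOfSize? G k = anySubset? λ p → isClique? G p ×-dec (∣ p ∣ ℕ.≟ k)

ω : ∀ {n} → Graph n → ℕ
ω {n} G = max 0 (filter (hasCliqueOfSize? G) (upTo (ℕ.suc n)))

-- A colour is assigned to every unordered pair over Fin n; only the values on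
-- edges matter, and every 2-colouring of the edges of a graph over Fin n is a
-- restriction of such an assignment.
record Colouring (n : ℕ) : Set where
  field
    colour      : Fin n → Fin n → Bool
    colour-symm : ∀ x y → colour x y ≡ colour y x

open Colouring public

MonochromaticTriangle : ∀ {n} → Graph n → Colouring n → Set
MonochromaticTriangle G c = ∃ λ x → ∃ λ y → ∃ λ z →
  Adj G x y × Adj G y z × Adj G x z ×
  colour c x y ≡ colour c y z × colour c y z ≡ colour c x z

infix 4 _⟶[3,3]
_⟶[3,3] : ∀ {n} → Graph n → Set
_⟶[3,3] {n} G = (c : Colouring n) → MonochromaticTriangle G c

MinimalRamsey : ∀ {n} → Graph n → Set₁
MinimalRamsey {n} G = G ⟶[3,3] × ((H : Graph n) → H ⊏ G → ¬ (H ⟶[3,3]))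

CombinedAdj : ∀ {m n} → Bool → Graph m → Graph n → Rel (Fin m ⊎ Fin n) 0ℓ
CombinedAdj b G H (inj₁ x) (inj₁ y) = Adj G x y
CombinedAdj b G H (inj₂ x) (inj₂ y) = Adj H x y
CombinedAdj b G H (inj₁ x) (inj₂ y) = x ∈ V G × y ∈ V H × T b
CombinedAdj b G H (inj₂ x) (inj₁ y) = x ∈ V H × y ∈ V G × T b

-- Side by side copies of G and H, with all edges (b = true) or no edges
-- (b = false) between them.
combine : ∀ {m n} → Bool → Graph m → Graph n → Graph (m ℕ.+ n)
combine {m} {n} b G H = record
  { V      = V G ++ V H
  ; Adj    = λ x y → CombinedAdj b G H (splitAt m x) (splitAt m y)
  ; adj?   = λ x y → dec (splitAt m x) (splitAt m y)
  ; symm   = λ {x} {y} → symm-⊎ (splitAt m x) (splitAt m y)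
  ; irrefl = λ { {x} refl → irrefl-⊎ (splitAt m x) }
  ; inV    = λ {x} {y} a → lookup⇒[]= x (V G ++ V H)
               (trans (lookup-splitAt m (V G) (V H) x)
                      (inV-⊎ (splitAt m x) (splitAt m y) a))
  }
  where
  dec : Decidable (CombinedAdj b G H)
  dec (inj₁ x) (inj₁ y) = adj? G x y
  dec (inj₂ x) (inj₂ y) = adj? H x y
  dec (inj₁ x) (inj₂ y) = (x ∈? V G) ×-dec ((y ∈? V H) ×-dec T? b)
  dec (inj₂ x) (inj₁ y) = (x ∈? V H) ×-dec ((y ∈? V G) ×-dec T? b)

  symm-⊎ : ∀ s t → CombinedAdj b G H s t → CombinedAdj b G H t s
  symm-⊎ (inj₁ x) (inj₁ y) a = symm G a
  symm-⊎ (inj₂ x) (inj₂ y) a = symm H a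
  symm-⊎ (inj₁ x) (inj₂ y) (p , q , t) = q , p , t
  symm-⊎ (inj₂ x) (inj₁ y) (p , q , t) = q , p , t

  irrefl-⊎ : ∀ s → ¬ CombinedAdj b G H s s
  irrefl-⊎ (inj₁ x) = irrefl G refl
  irrefl-⊎ (inj₂ x) = irrefl H refl

  inV-⊎ : ∀ s t → CombinedAdj b G H s t →
          [ lookup (V G) , lookup (V H) ]′ s ≡ true
  inV-⊎ (inj₁ x) (inj₁ y) a = []=⇒lookup (inV G a)
  inV-⊎ (inj₂ x) (inj₂ y) a = []=⇒lookup (inV H a)
  inV-⊎ (inj₁ x) (inj₂ y) (p , _) = []=⇒lookup p
  inV-⊎ (inj₂ x) (inj₁ y) (p , _) = []=⇒lookup p

infixl 6 _⊕_ _∪ᴳ_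
_⊕_ : ∀ {m n} → Graph m → Graph n → Graph (m ℕ.+ n)
_⊕_ = combine true

_∪ᴳ_ : ∀ {m n} → Graph m → Graph n → Graph (m ℕ.+ n)
_∪ᴳ_ = combine false

K : ∀ n → Graph n
K n = record
  { V      = ⊤
  ; Adj    = _≢_
  ; adj?   = λ x y → ¬? (x ≟ y)
  ; symm   = λ x≢y y≡x → x≢y (sym y≡x)
  ; irrefl = λ x≡y x≢y → x≢y x≡y
  ; inV    = λ _ → ∈⊤
  }

Consecutive : ∀ {n} → Rel (Fin n) 0ℓ
Consecutive x y = ℕ.suc (toℕ x) ≡ toℕ y

P : ∀ n → Graph n
P n = record
  { V      = ⊤
  ; Adj    = λ x y → Consecutive x y ⊎ Consecutive y x
  ; adj?   = λ x y → (ℕ.suc (toℕ x) ℕ.≟ toℕ y) ⊎-dec (ℕ.suc (toℕ y) ℕ.≟ toℕ x)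
  ; symm   = swap
  ; irrefl = λ { refl → [ 1+n≢n , 1+n≢n ]′ }
  ; inV    = λ _ → ∈⊤
  }

-- C k is the cycle on 3 + k vertices.
C : ∀ k → Graph (3 ℕ.+ k)
C k = record
  { V      = ⊤
  ; Adj    = λ x y → Adj (P _) x y ⊎ (Ends x y ⊎ Ends y x)
  ; adj?   = λ x y → adj? (P _) x y ⊎-dec (ends? x y ⊎-dec ends? y x)
  ; symm   = λ { (inj₁ a) → inj₁ (swap a) ; (inj₂ e) → inj₂ (swap e) }
  ; irrefl = λ { refl → [ irrefl (P _) refl , [ ends-irrefl , ends-irrefl ]′ ]′ }
  ; inV    = λ _ → ∈⊤
  }
  where
  Ends : Rel (Fin (3 ℕ.+ k)) 0ℓ
  Ends x y = x ≡ zero × y ≡ fromℕ (2 ℕ.+ k)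

  ends? : Decidable Ends
  ends? x y = (x ≟ zero) ×-dec (y ≟ fromℕ (2 ℕ.+ k))

  ends-irrefl : ∀ {x} → ¬ Ends x x
  ends-irrefl (refl , ())

N₅₋₁ N₅₋₂ N₅₋₃ : Graph 5
N₅₋₁ = K 1 ⊕ (K 2 ∪ᴳ K 2)
N₅₋₂ = K 1 ⊕ P 4
N₅₋₃ = K 1 ⊕ C 1

{-# OPTIONS --safe #-}

-- By minimality G − v has a 2-colouring without monochromatic triangles for
-- every vertex v, and no colouring of the edges at v extends it to G.  But if
-- G(v) splits into an independent set A and a set B spanning at most one edge,
-- then giving the edges from v to A the colour of that edge, and the edges from
-- v to B the other colour, is such an extension.  Every graph on five vertices
-- that has no such splitting and no K₄ is one of the N₅₋ᵢ, which is checked over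
-- all graphs and relabellings; K₄ in G(v) is excluded by ω(G) ≤ 4.  If d(v) < 5
-- the same applies after adding isolated vertices to G(v), and the N₅₋ᵢ have none.
module Submission where

open import Defs
open import Data.Fin.Subset using (_∈_)
open import Data.Nat using (ℕ; _≤_; _≥_)
open import Data.Product using (_×_)
open import Data.Sum using (_⊎_)
open import Relation.Binary.PropositionalEquality using (_≡_)

open import Data.Bool using (Bool; true; false; not; if_then_else_)
import Data.Bool.Properties as Bool
open import Data.Empty using (⊥; ⊥-elim)
open import Data.Fin using (Fin; zero; suc; _≟_; inject₁; splitAt; _↑ˡ_; _↑ʳ_)
open import Data.Fin.Patterns using (0F; 1F; 2F; 3F; 4F)
open import Data.Fin.Permutation using (Permutation; Permutation′; _⟨$⟩ʳ_; _⟨$⟩ˡ_; inverseʳ; inverseˡ; _∘ₚ_; lift₀; transpose; id)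
open import Data.Fin.Properties using (all?; any?; splitAt-↑ˡ; splitAt-↑ʳ; suc-injective; 0≢1+n)
open import Data.Fin.Subset using (Subset; ∁; ⁅_⁆; ∣_∣; _-_)
open import Data.Fin.Subset.Properties using (_∈?_; anySubset?; x∈p∩q⁻; x∈∁p⇒x∉p; x∉p⇒x∈∁p; x∈⁅x⁆; x≢y⇒x∉⁅y⁆; ∣p∣≤n; x∈p∧x≢y⇒x∈p-y; x∈p⇒∣p-x∣<∣p∣)
open import Data.List using (List; []; _∷_; allFin; cartesianProductWith)
open import Data.List.Extrema.Nat using (v≤min⁺; v≤max⁺)
import Data.List.Membership.Propositional.Properties as List
import Data.List.Relation.Unary.All as All
import Data.List.Relation.Unary.All.Properties as All
open import Data.List.Relation.Unary.Any as Any using (Any)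
open import Data.Nat using (zero; suc; _+_; z≤n; s≤s)
open import Data.Nat.Properties using (≤-trans; ≤-reflexive; <⇒≱; ≮⇒≥; +-suc; m≤n⇒∃[o]m+o≡n)
open import Data.Product using (_,_; ∃; proj₁; proj₂)
open import Data.Sum as Sum using (inj₁; inj₂; [_,_]′)
open import Data.Unit using (⊤; tt)
open import Data.Vec using ([]; _∷_; here; there; lookup; tabulate)
open import Data.Vec.Properties using (lookup∘tabulate; lookup⇒[]=; []=⇒lookup)
open import Data.Vec.Properties.WithK using ([]=-irrelevant)
open import Function using (_∘_; const; _⇔_; mk⇔; mk↔ₛ′)
open import Function.Definitions using (Injective)
open import Relation.Binary.PropositionalEquality using (_≢_; refl; sym; trans; cong)
open import Relation.Nullary using (Dec; yes; no; does; ¬_; ¬?; contradiction)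
open import Relation.Nullary.Decidable using (dec-true; dec-false; decidable-stable; from-yes; map′; _×-dec_; _⊎-dec_; _→-dec_)

private variable
  m n : ℕ

-- Decidable predicates, subsets of `Fin n` and their enumeration.

Matrix : ℕ → Set
Matrix m = Fin m → Fin m → Bool

≡does⇒⇔ : ∀ {A B : Set} (a? : Dec A) (b? : Dec B) → does a? ≡ does b? → A ⇔ B
≡does⇒⇔ (yes a) (yes b) _ = mk⇔ (const b) (const a)
≡does⇒⇔ (no ¬a) (no ¬b) _ = mk⇔ (λ a → contradiction a ¬a) (λ b → contradiction b ¬b)

does≡true⇒ : ∀ {A : Set} (a? : Dec A) → does a? ≡ true → A
does≡true⇒ (yes a) _ = a

module _ {P : Fin n → Set} (P? : ∀ i → Dec (P i)) where

  ∈-comprehension⁺ : ∀ {i} → P i → i ∈ tabulate (does ∘ P?)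
  ∈-comprehension⁺ {i} pi =
    lookup⇒[]= i _ (trans (lookup∘tabulate (does ∘ P?) i) (dec-true (P? i) pi))

  ∈-comprehension⁻ : ∀ {i} → i ∈ tabulate (does ∘ P?) → P i
  ∈-comprehension⁻ {i} i∈ =
    does≡true⇒ (P? i) (trans (sym (lookup∘tabulate (does ∘ P?) i)) ([]=⇒lookup i∈))

-- Induction on `k`: removing `f zero` from `p` lowers its size, and by injectivity the remaining
-- values stay in what is left.
injection⇒≤∣∣ : ∀ {k} (p : Subset n) (f : Fin k → Fin n) →
                Injective _≡_ _≡_ f → (∀ i → f i ∈ p) → k ≤ ∣ p ∣
injection⇒≤∣∣ {k = zero}  p f inj f∈p = z≤n
injection⇒≤∣∣ {k = suc k} p f inj f∈p =
  ≤-trans (s≤s (injection⇒≤∣∣ (p - f zero) (f ∘ suc) (suc-injective ∘ inj)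
                 λ i → x∈p∧x≢y⇒x∈p-y (f∈p (suc i)) (0≢1+n ∘ sym ∘ inj)))
          (x∈p⇒∣p-x∣<∣p∣ (f∈p zero))

enumerate : (p : Subset n) → Fin ∣ p ∣ → Fin n
enumerate (true  ∷ p) zero    = zero
enumerate (true  ∷ p) (suc i) = suc (enumerate p i)
enumerate (false ∷ p) i       = suc (enumerate p i)

enumerate-injective : (p : Subset n) → Injective _≡_ _≡_ (enumerate p)
enumerate-injective (true  ∷ p) {zero}  {zero}  eq = refl
enumerate-injective (true  ∷ p) {suc i} {suc j} eq =
  cong suc (enumerate-injective p (suc-injective eq))
enumerate-injective (false ∷ p) eq = enumerate-injective p (suc-injective eq)

enumerate-surjective : (p : Subset n) → ∀ {x} → x ∈ p → ∃ λ i → enumerate p i ≡ x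
enumerate-surjective (true  ∷ p) here = zero , refl
enumerate-surjective (true  ∷ p) (there x∈p) =
  let i , eq = enumerate-surjective p x∈p in suc i , cong suc eq
enumerate-surjective (false ∷ p) (there x∈p) =
  let i , eq = enumerate-surjective p x∈p in i , cong suc eq

-- Adjacency matrices, neighbourhoods and the clique number.

module _ (G : Graph n) where

  adjMatrix : Matrix n
  adjMatrix x y = does (adj? G x y)

  adjMatrix-sym : ∀ x y → adjMatrix x y ≡ adjMatrix y x
  adjMatrix-sym x y with adj? G x y
  ... | yes xy = sym (dec-true (adj? G y x) (symm G xy))
  ... | no ¬xy = sym (dec-false (adj? G y x) (¬xy ∘ symm G))

  adjMatrix-irrefl : ∀ x → adjMatrix x x ≡ false
  adjMatrix-irrefl x = dec-false (adj? G x x) (irrefl G refl)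

  ∈N⇒Adj : ∀ {v u} → u ∈ N G v → Adj G v u
  ∈N⇒Adj {v} = ∈-comprehension⁻ (adj? G v)

  Adj⇒∈N : ∀ {v u} → Adj G v u → u ∈ N G v
  Adj⇒∈N {v} = ∈-comprehension⁺ (adj? G v)

  -- Distinct indices have adjacent, hence distinct, values, so `f` is injective and its image is a
  -- clique with at least `k` vertices.
  clique⇒≤ω : ∀ {k} (f : Fin k → Fin n) → (∀ i → f i ∈ V G) →
              (∀ i j → i ≢ j → Adj G (f i) (f j)) → k ≤ ω G
  clique⇒≤ω {k} f f∈V adj = ≤-trans k≤∣image∣ ∣image∣≤ω
    where
    inImage? : ∀ u → Dec (∃ λ i → f i ≡ u)
    inImage? u = any? λ i → f i ≟ u

    image : Subset n
    image = tabulate (does ∘ inImage?)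

    f-injective : Injective _≡_ _≡_ f
    f-injective {i} {j} eq with i ≟ j
    ... | yes i≡j = i≡j
    ... | no  i≢j = contradiction (adj i j i≢j) (irrefl G eq)

    k≤∣image∣ : k ≤ ∣ image ∣
    k≤∣image∣ = injection⇒≤∣∣ image f f-injective λ i → ∈-comprehension⁺ inImage? (i , refl)

    isClique : IsClique G image
    isClique = (λ u∈ → case-V (∈-comprehension⁻ inImage? u∈))
             , λ x y x∈ y∈ → case-adj (∈-comprehension⁻ inImage? x∈) (∈-comprehension⁻ inImage? y∈)
      where
      case-V : ∀ {u} → (∃ λ i → f i ≡ u) → u ∈ V G
      case-V (i , refl) = f∈V i
      case-adj : ∀ {x y} → (∃ λ i → f i ≡ x) → (∃ λ j → f j ≡ y) → x ≢ y → Adj G x y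
      case-adj (i , refl) (j , refl) fi≢fj = adj i j (fi≢fj ∘ cong f)

    ∣image∣≤ω : ∣ image ∣ ≤ ω G
    -- `ω` is a maximum over the sizes `0` to `n`; the bound `∣p∣≤n` puts the size of the image
    -- among them.
    ∣image∣≤ω = v≤max⁺ 0 _ (inj₂ (Any.map ≤-reflexive
      (List.∈-filter⁺ (hasCliqueOfSize? G) (List.∈-upTo⁺ (s≤s (∣p∣≤n image)))
                      (image , isClique , refl))))

-- Exhaustive classification of the graphs on five vertices.

UpperTriangle : ℕ → Set
UpperTriangle zero    = ⊤
UpperTriangle (suc m) = Subset m × UpperTriangle m

-- Only the entries above the diagonal are free, so for five vertices the search runs over 2^10
-- graphs instead of 2^25 Boolean matrices.
symmetrize : ∀ {m} → UpperTriangle m → Matrix m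
symmetrize (r , t) zero    zero    = false
symmetrize (r , t) zero    (suc j) = lookup r j
symmetrize (r , t) (suc i) zero    = lookup r i
symmetrize (r , t) (suc i) (suc j) = symmetrize t i j

allSubsets? : ∀ {m} {P : Subset m → Set} → (∀ p → Dec (P p)) → Dec (∀ p → P p)
allSubsets? P? = map′ (λ ¬∃ p → decidable-stable (P? p) λ ¬p → ¬∃ (p , ¬p))
                      (λ all (p , ¬p) → ¬p (all p))
                      (¬? (anySubset? (¬? ∘ P?)))

allTriangles? : ∀ m {P : UpperTriangle m → Set} → (∀ t → Dec (P t)) → Dec (∀ t → P t)
allTriangles? zero    P? = map′ (λ p _ → p) (λ all → all tt) (P? tt)
allTriangles? (suc m) P? = map′ (λ all (r , t) → all r t) (λ all r t → all (r , t))
  (allSubsets? λ r → allTriangles? m λ t → P? (r , t))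

-- Each permutation is determined by the image `i` of `zero` and a permutation of the rest:
-- `lift₀ π` fixes `zero`, and the transposition then moves it to `i`.
permutations : ∀ m → List (Permutation′ m)
permutations zero    = id ∷ []
permutations (suc m) =
  cartesianProductWith (λ i π → lift₀ π ∘ₚ transpose zero i) (allFin (suc m)) (permutations m)

-- Inspecting the first four labels is enough, since the search also ranges over relabellings that
-- bring a 4-clique there.
HasK4 : Matrix 5 → Set
HasK4 e = ∀ (i j : Fin 4) → i ≢ j → e (inject₁ i) (inject₁ j) ≡ true

-- Only used with s 3F ≡ s 4F ≡ false, so that the vertices with s true are
-- independent.
Split : (Fin 5 → Bool) → Matrix 5 → Set
Split s e = ∀ i j → s i ≡ s j → e i j ≡ true → (i ≡ 3F × j ≡ 4F) ⊎ (i ≡ 4F × j ≡ 3F)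

Matches : ∀ {m} → Graph m → Matrix m → Set
Matches H e = ∀ i j → e i j ≡ adjMatrix H i j

-- The candidates for the independent side, up to relabelling. That sizes two and three suffice is
-- confirmed by `classification`.
firstTwo firstThree : Fin 5 → Bool
firstTwo 0F = true
firstTwo 1F = true
firstTwo _  = false
firstThree 2F = true
firstThree i  = firstTwo i

MatchesN₅ : Matrix 5 → Set
MatchesN₅ e = Matches N₅₋₁ e ⊎ Matches N₅₋₂ e ⊎ Matches N₅₋₃ e

Shape : Matrix 5 → Set
Shape e = (Split firstTwo e ⊎ Split firstThree e) ⊎ HasK4 e ⊎ MatchesN₅ e

split? : ∀ s e → Dec (Split s e)
split? s e = all? λ i → all? λ j → (s i Bool.≟ s j) →-dec ((e i j Bool.≟ true) →-dec
  (((i ≟ 3F) ×-dec (j ≟ 4F)) ⊎-dec ((i ≟ 4F) ×-dec (j ≟ 3F))))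

matches? : ∀ {m} (H : Graph m) e → Dec (Matches H e)
matches? H e = all? λ i → all? λ j → e i j Bool.≟ adjMatrix H i j

hasK4? : ∀ e → Dec (HasK4 e)
hasK4? e = all? λ i → all? λ j → ¬? (i ≟ j) →-dec (e (inject₁ i) (inject₁ j) Bool.≟ true)

shape? : ∀ e → Dec (Shape e)
shape? e = (split? firstTwo e ⊎-dec split? firstThree e) ⊎-dec
  (hasK4? e ⊎-dec
   (matches? N₅₋₁ e ⊎-dec (matches? N₅₋₂ e ⊎-dec matches? N₅₋₃ e)))

relabel : ∀ {l} {A : Set} → (Fin l → A) → (A → A → Bool) → Fin l → Fin l → Bool
relabel f e i j = e (f i) (f j)

-- Opaque, since unfolding it elsewhere would repeat the search over all graphs.
opaque
  classification : ∀ t → Any (λ π → Shape (relabel (π ⟨$⟩ʳ_) (symmetrize t))) (permutations 5)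
  classification = from-yes (allTriangles? 5 λ t →
    Any.any? (λ π → shape? (relabel (π ⟨$⟩ʳ_) (symmetrize t))) (permutations 5))

triangleOf : Matrix m → UpperTriangle m
triangleOf {zero}  e = tt
triangleOf {suc m} e = tabulate (λ j → e zero (suc j)) , triangleOf (λ i j → e (suc i) (suc j))

symmetrize-triangleOf : (e : Matrix m) → (∀ i j → e i j ≡ e j i) → (∀ i → e i i ≡ false) →
                        ∀ i j → symmetrize (triangleOf e) i j ≡ e i j
symmetrize-triangleOf e e-sym e-irr zero    zero    = sym (e-irr zero)
symmetrize-triangleOf e e-sym e-irr zero    (suc j) = lookup∘tabulate _ j
symmetrize-triangleOf e e-sym e-irr (suc i) zero    =
  trans (lookup∘tabulate _ i) (e-sym zero (suc i))
symmetrize-triangleOf e e-sym e-irr (suc i) (suc j) =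
  symmetrize-triangleOf _ (λ i j → e-sym (suc i) (suc j)) (e-irr ∘ suc) i j

-- Decoding an encoded matrix restores it only entry by entry, so shapes are carried along pointwise
-- equality.
shape-resp : ∀ {e e′ : Matrix 5} → (∀ i j → e i j ≡ e′ i j) → Shape e → Shape e′
shape-resp {e} {e′} eq =
  Sum.map (Sum.map (split firstTwo) (split firstThree))
    (Sum.map k4 (Sum.map (matches N₅₋₁) (Sum.map (matches N₅₋₂) (matches N₅₋₃))))
  where
  split : ∀ s → Split s e → Split s e′
  split s sp i j same ij = sp i j same (trans (eq i j) ij)
  k4 : HasK4 e → HasK4 e′
  k4 k i j i≢j = trans (sym (eq _ _)) (k i j i≢j)
  matches : ∀ (H : Graph 5) → Matches H e → Matches H e′
  matches H f i j = trans (sym (eq i j)) (f i j)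

shape-of-relabelling : (e : Matrix 5) → (∀ i j → e i j ≡ e j i) → (∀ i → e i i ≡ false) →
  ∃ λ (π : Permutation′ 5) → Shape (relabel (π ⟨$⟩ʳ_) e)
shape-of-relabelling e e-sym e-irr =
  let π , shape = Any.satisfied (classification (triangleOf e))
  in  π , shape-resp (λ i j → symmetrize-triangleOf e e-sym e-irr _ _) shape

-- Extending a colouring of `G` minus `v` over the edges at `v`.

recolour : Colouring n → Fin n → (Fin n → Bool) → Colouring n
recolour c v a = record
  { colour = col ; colour-symm = col-symm }
  where
  col : _ → _ → Bool
  col x y = if does (x ≟ v) then a y else if does (y ≟ v) then a x else colour c x y
  col-symm : ∀ x y → col x y ≡ col y x
  col-symm x y with x ≟ v | y ≟ v
  ... | yes refl | yes refl = refl
  ... | yes _    | no  _    = refl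
  ... | no  _    | yes _    = refl
  ... | no  _    | no  _    = colour-symm c x y

module _ (c : Colouring n) (v : Fin n) (a : Fin n → Bool) where

  recolour-at : ∀ y → colour (recolour c v a) v y ≡ a y
  recolour-at y rewrite dec-true (v ≟ v) refl = refl

  recolour-away : ∀ {x y} → x ≢ v → y ≢ v → colour (recolour c v a) x y ≡ colour c x y
  recolour-away {x} {y} x≢v y≢v
    rewrite dec-false (x ≟ v) x≢v | dec-false (y ≟ v) y≢v = refl

-- With `H` the neighbourhood of `v` and `a u` the colour of the edge from `v` to `u`, this rules
-- out monochromatic triangles through `v`.
Extends : (H : Graph n) → Colouring n → (Fin n → Bool) → Set
Extends H c a = ∀ {u w} → Adj H u w → a u ≡ a w → colour c u w ≢ a u

-- If every `c` had an extension, `G-v` would itself be Ramsey, against minimality: the recoloured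
-- `G` has a monochromatic triangle, which by `Extends` avoids `v`, so it is already monochromatic
-- for `c` in `G-v`.
not-extendable : (G : Graph n) → MinimalRamsey G → ∀ {v} → v ∈ V G →
                 ¬ (∀ c → ∃ (Extends (G ⟨ v ⟩) c))
not-extendable {n} G (ramsey , minimal) {v} v∈V ext = minimal G-v (G-v⊑G , G⋢G-v) G-v-ramsey
  where
  G-v : Graph n
  G-v = induced G (∁ ⁅ v ⁆)

  G-v⊑G : G-v ⊑ G
  G-v⊑G = proj₁ ∘ x∈p∩q⁻ (V G) (∁ ⁅ v ⁆) , proj₁

  G⋢G-v : ¬ (G ⊑ G-v)
  G⋢G-v (V⊆ , _) = x∈∁p⇒x∉p (proj₂ (x∈p∩q⁻ (V G) (∁ ⁅ v ⁆) (V⊆ v∈V))) (x∈⁅x⁆ v)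

  G-v-ramsey : G-v ⟶[3,3]
  G-v-ramsey c with ext c
  ... | a , extends with ramsey (recolour c v a)
  ... | x , y , z , xy , yz , xz , xy≡yz , yz≡xz = triangle (x ≟ v) (y ≟ v) (z ≟ v)
    where
    c′ : Fin n → Fin n → Bool
    c′ = colour (recolour c v a)

    c′-sym : ∀ p q → c′ p q ≡ c′ q p
    c′-sym = colour-symm (recolour c v a)

    away : ∀ {u} → Adj G v u → u ≢ v
    away vu u≡v = irrefl G (sym u≡v) vu

    not-at-v : ∀ {u w} → Adj G v u → Adj G v w → Adj G u w →
               c′ v u ≡ c′ v w → c′ u w ≡ c′ v u → ⊥
    not-at-v {u} {w} vu vw uw vu≡vw uw≡vu =
      extends (uw , Adj⇒∈N G vu , Adj⇒∈N G vw)
        (trans (sym (recolour-at c v a u)) (trans vu≡vw (recolour-at c v a w)))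
        (trans (sym (recolour-away c v a (away vu) (away vw)))
               (trans uw≡vu (recolour-at c v a u)))

    -- Whichever corner is `v`, symmetry of adjacency and of colours brings the triangle into the
    -- form refuted by `not-at-v`.
    triangle : Dec (x ≡ v) → Dec (y ≡ v) → Dec (z ≡ v) → MonochromaticTriangle G-v c
    triangle (yes refl) _ _ =
      ⊥-elim (not-at-v xy xz yz (trans xy≡yz yz≡xz) (sym xy≡yz))
    triangle _ (yes refl) _ =
      ⊥-elim (not-at-v (symm G xy) yz xz (trans (c′-sym v x) xy≡yz)
                       (trans (sym yz≡xz) (trans (sym xy≡yz) (c′-sym x v))))
    triangle _ _ (yes refl) =
      ⊥-elim (not-at-v (symm G xz) (symm G yz) xy
                       (trans (c′-sym v x) (trans (sym yz≡xz) (c′-sym y v)))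
                       (trans xy≡yz (trans yz≡xz (c′-sym x v))))
    triangle (no x≢v) (no y≢v) (no z≢v) =
      x , y , z , (xy , x∈ , y∈) , (yz , y∈ , z∈) , (xz , x∈ , z∈) ,
      transport x≢v y≢v y≢v z≢v xy≡yz , transport y≢v z≢v x≢v z≢v yz≡xz
      where
      x∈ = x∉p⇒x∈∁p (x≢y⇒x∉⁅y⁆ x≢v)
      y∈ = x∉p⇒x∈∁p (x≢y⇒x∉⁅y⁆ y≢v)
      z∈ = x∉p⇒x∈∁p (x≢y⇒x∉⁅y⁆ z≢v)
      transport : ∀ {p q r s} → p ≢ v → q ≢ v → r ≢ v → s ≢ v → c′ p q ≡ c′ r s →
                  colour c p q ≡ colour c r s
      transport p≢v q≢v r≢v s≢v eq =
        trans (sym (recolour-away c v a p≢v q≢v)) (trans eq (recolour-away c v a r≢v s≢v))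

-- Excluding splittings and 4-cliques in the neighbourhood of `v`.

paint : Bool → Bool → Bool
paint κ s = if s then κ else not κ

-- Recovers the side of a neighbour from the colour of its edge to `v`.
paint-injective : ∀ κ → Injective _≡_ _≡_ (paint κ)
paint-injective κ     {true}  {true}  _ = refl
paint-injective κ     {false} {false} _ = refl
paint-injective true  {true}  {false} ()
paint-injective true  {false} {true}  ()
paint-injective false {true}  {false} ()
paint-injective false {false} {true}  ()

-- Labels may also take values outside `p`, which allows a neighbourhood of fewer than five vertices
-- to be labelled by five indices.
Covers : (Fin m → Fin n) → Subset n → Set
Covers x p = ∀ {u} → u ∈ p → ∃ λ i → x i ≡ u

module _ (G : Graph n) (mr : MinimalRamsey G) {v : Fin n} (v∈V : v ∈ V G) where

  private
    A : Matrix n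
    A = adjMatrix (G ⟨ v ⟩)

  -- A triangle on `v`, `u`, `w` can be monochromatic only if `u` and `w` lie on the same side. The
  -- one edge allowed there joins the labels `3F` and `4F`; it has colour `κ c`, while its ends,
  -- where `s` is false, are joined to `v` in the other colour.
  not-split : ∀ (y : Fin 5 → Fin n) → Covers y (N G v) →
              ∀ s → s 3F ≡ false → ¬ Split s (relabel y A)
  not-split y covers s s₃≡false split = not-extendable G mr v∈V λ c → a c , extends c
    where
    κ : Colouring n → Bool
    κ c = colour c (y 3F) (y 4F)

    a : Colouring n → Fin n → Bool
    a c u with u ∈? N G v
    ... | yes u∈ = paint (κ c) (s (proj₁ (covers u∈)))
    -- An arbitrary value: `Extends` looks only at neighbours of `v`.
    ... | no  _  = true

    label : ∀ c {u} → u ∈ N G v → ∃ λ i → y i ≡ u × a c u ≡ paint (κ c) (s i)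
    label c {u} u∈ with u ∈? N G v
    ... | yes u∈′ = proj₁ (covers u∈′) , proj₂ (covers u∈′) , refl
    ... | no  u∉  = contradiction u∈ u∉

    κ≢ : ∀ c → κ c ≢ paint (κ c) (s 3F)
    κ≢ c eq with κ c | trans eq (cong (paint (κ c)) s₃≡false)
    ... | true  | ()
    ... | false | ()

    extends : ∀ c → Extends (G ⟨ v ⟩) c (a c)
    extends c {u} {w} uw au≡aw cuw≡au with label c (proj₁ (proj₂ uw)) | label c (proj₂ (proj₂ uw))
    ... | i , refl , au | j , refl , aw
      with split i j (paint-injective (κ c) (trans (sym au) (trans au≡aw aw)))
                 (dec-true (adj? (G ⟨ v ⟩) (y i) (y j)) uw)
    ... | inj₁ (refl , refl) = κ≢ c (trans cuw≡au au)
    ... | inj₂ (refl , refl) = κ≢ c (trans (colour-symm c _ _) (trans cuw≡au (trans au≡aw aw)))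

  module _ (ω≤4 : ω G ≤ 4) where

    -- Together with `v` the four vertices would form a 5-clique.
    not-K4 : ∀ (y : Fin 5 → Fin n) → ¬ HasK4 (relabel y A)
    not-K4 y k4 = <⇒≱ (clique⇒≤ω G f f∈V f-adj) ω≤4
      where
      f : Fin 5 → Fin n
      f zero    = v
      f (suc i) = y (inject₁ i)

      adj : ∀ i j → i ≢ j → Adj (G ⟨ v ⟩) (y (inject₁ i)) (y (inject₁ j))
      adj i j i≢j = does≡true⇒ (adj? (G ⟨ v ⟩) _ _) (k4 i j i≢j)

      -- That `y (inject₁ i)` is a neighbour of `v` is read off from an edge of `G ⟨ v ⟩` at it, so
      -- each index needs a partner.
      another : ∀ (i : Fin 4) → ∃ λ j → i ≢ j
      another zero    = 1F , λ ()
      another (suc i) = 0F , λ ()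

      v-adj : ∀ i → Adj G v (y (inject₁ i))
      v-adj i = let j , i≢j = another i in ∈N⇒Adj G (proj₁ (proj₂ (adj i j i≢j)))

      f∈V : ∀ i → f i ∈ V G
      f∈V zero    = v∈V
      f∈V (suc i) = inV G (symm G (v-adj i))

      f-adj : ∀ i j → i ≢ j → Adj G (f i) (f j)
      f-adj zero    zero    i≢j = contradiction refl i≢j
      f-adj zero    (suc j) i≢j = v-adj j
      f-adj (suc i) zero    i≢j = symm G (v-adj i)
      f-adj (suc i) (suc j) i≢j = proj₁ (adj i j (i≢j ∘ cong suc))

    -- The size is tied to 5 by an equation because the index sets it is applied to have sizes
    -- `d G v` and `d G v + suc o`, which do not compute to 5.
    neighbourhood-shape : ∀ (x : Fin m → Fin n) → m ≡ 5 → Covers x (N G v) →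
      ∃ λ (π : Permutation 5 m) → MatchesN₅ (relabel (x ∘ (π ⟨$⟩ʳ_)) A)
    neighbourhood-shape x refl covers =
      exclude (shape-of-relabelling (relabel x A) (λ i j → adjMatrix-sym (G ⟨ v ⟩) (x i) (x j))
                                    (λ i → adjMatrix-irrefl (G ⟨ v ⟩) (x i)))
      where
      y-covers : ∀ (π : Permutation′ 5) → Covers (x ∘ (π ⟨$⟩ʳ_)) (N G v)
      y-covers π u∈ = let i , xi≡u = covers u∈ in
        π ⟨$⟩ˡ i , trans (cong x (inverseʳ π)) xi≡u

      exclude : (∃ λ (π : Permutation′ 5) → Shape (relabel (x ∘ (π ⟨$⟩ʳ_)) A)) →
                ∃ λ (π : Permutation′ 5) → MatchesN₅ (relabel (x ∘ (π ⟨$⟩ʳ_)) A)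
      exclude (π , inj₁ split)          =
        ⊥-elim ([ not-split (x ∘ (π ⟨$⟩ʳ_)) (y-covers π) firstTwo refl
                , not-split (x ∘ (π ⟨$⟩ʳ_)) (y-covers π) firstThree refl ]′ split)
      exclude (π , inj₂ (inj₁ k4))      = ⊥-elim (not-K4 (x ∘ (π ⟨$⟩ʳ_)) k4)
      exclude (π , inj₂ (inj₂ matches)) = π , matches

-- From matching adjacency matrices to isomorphism.

NoIsolated : Graph m → Set
NoIsolated K = ∀ i → ∃ λ j → Adj K i j

noIsolated? : (K : Graph m) → Dec (NoIsolated K)
noIsolated? K = all? λ i → any? λ j → adj? K i j

N₅₋₁-noIsolated : NoIsolated N₅₋₁
N₅₋₁-noIsolated = from-yes (noIsolated? N₅₋₁)

N₅₋₂-noIsolated : NoIsolated N₅₋₂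
N₅₋₂-noIsolated = from-yes (noIsolated? N₅₋₂)

N₅₋₃-noIsolated : NoIsolated N₅₋₃
N₅₋₃-noIsolated = from-yes (noIsolated? N₅₋₃)

matched-noIsolated : (H : Graph n) (K : Graph m) → NoIsolated K → (y : Fin m → Fin n) →
                     Matches K (relabel y (adjMatrix H)) → ∀ i → ∃ λ j → Adj H (y i) (y j)
matched-noIsolated H K noIso y match i =
  let j , ij = noIso i in
  j , does≡true⇒ (adj? H (y i) (y j)) (trans (match i j) (dec-true (adj? K i j) ij))

-- The isomorphism sends a vertex to its label. Adjacency is compared by `match`; having a neighbour
-- shows that each label is a vertex of `K` and its value under `y` a vertex of `H`.
matches⇒≅ : (H : Graph n) (K : Graph m) (y : Fin m → Fin n) →
            Injective _≡_ _≡_ y → Covers y (V H) → NoIsolated K →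
            Matches K (relabel y (adjMatrix H)) → H ≅ K
matches⇒≅ H K y y-inj covers noIso match =
  mk↔ₛ′ to from to∘from from∘to , λ (u , u∈) (w , w∈) → adj (covers u∈) (covers w∈)
  where
  y∈V : ∀ i → y i ∈ V H
  y∈V i = inV H (proj₂ (matched-noIsolated H K noIso y match i))

  vertex-≡ : ∀ {l} {G : Graph l} {u w : Vertex G} → proj₁ u ≡ proj₁ w → u ≡ w
  vertex-≡ refl = cong (_ ,_) ([]=-irrelevant _ _)

  to : Vertex H → Vertex K
  to (u , u∈) = proj₁ (covers u∈) , inV K (proj₂ (noIso _))

  from : Vertex K → Vertex H
  from (i , _) = y i , y∈V i

  to∘from : ∀ k → to (from k) ≡ k
  to∘from (i , _) = vertex-≡ {G = K} (y-inj (proj₂ (covers (y∈V i))))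

  from∘to : ∀ h → from (to h) ≡ h
  from∘to (u , u∈) = vertex-≡ {G = H} (proj₂ (covers u∈))

  adj : ∀ {u w} (p : ∃ λ i → y i ≡ u) (q : ∃ λ j → y j ≡ w) →
        Adj H u w ⇔ Adj K (proj₁ p) (proj₁ q)
  adj (i , refl) (j , refl) = ≡does⇒⇔ (adj? H (y i) (y j)) (adj? K i j) (match i j)

-- Minimum degree and the neighbourhoods of vertices of degree five.

module _ (G : Graph n) (mr : MinimalRamsey G) (ω≤4 : ω G ≤ 4) where

  d≥5 : ∀ {v} → v ∈ V G → d G v ≥ 5
  d≥5 {v} v∈V = ≮⇒≥ λ d<5 → low (m≤n⇒∃[o]m+o≡n d<5)
    where
    -- The strict inequality makes the padding `suc o` nonempty, so that at least one label is sent
    -- to `v`.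
    low : ¬ (∃ λ o → suc (d G v) + o ≡ 5)
    low (o , eq) = conclude (neighbourhood-shape G mr v∈V ω≤4 x (trans (+-suc (d G v) o) eq) covers)
      where
      -- Padding with v itself is harmless: v is not a vertex of G(v), whereas the
      -- N₅₋ᵢ have no isolated vertex.
      x : Fin (d G v + suc o) → Fin n
      x = [ enumerate (N G v) , const v ]′ ∘ splitAt (d G v)

      covers : Covers x (N G v)
      covers u∈ = let i , eq′ = enumerate-surjective (N G v) u∈ in
        i ↑ˡ suc o , trans (cong [ enumerate (N G v) , const v ]′ (splitAt-↑ˡ (d G v) i (suc o))) eq′

      v-index : ∃ λ i → x i ≡ v
      v-index = d G v ↑ʳ zero , cong [ enumerate (N G v) , const v ]′ (splitAt-↑ʳ (d G v) (suc o) zero)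

      impossible : (π : Permutation 5 (d G v + suc o)) (K : Graph 5) → NoIsolated K →
                   ¬ Matches K (relabel (x ∘ (π ⟨$⟩ʳ_)) (adjMatrix (G ⟨ v ⟩)))
      impossible π K noIso match =
        let i , xi≡v = v-index
            j , (_ , y∈N , _) = matched-noIsolated (G ⟨ v ⟩) K noIso (x ∘ (π ⟨$⟩ʳ_)) match (π ⟨$⟩ˡ i)
        in  irrefl G (sym (trans (cong x (inverseʳ π)) xi≡v)) (∈N⇒Adj G y∈N)

      conclude : ¬ (∃ λ (π : Permutation 5 (d G v + suc o)) →
                      MatchesN₅ (relabel (x ∘ (π ⟨$⟩ʳ_)) (adjMatrix (G ⟨ v ⟩))))
      conclude (π , match) =
        [ impossible π N₅₋₁ N₅₋₁-noIsolated
        , [ impossible π N₅₋₂ N₅₋₂-noIsolated , impossible π N₅₋₃ N₅₋₃-noIsolated ]′ ]′ match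

  δ≥5 : δ G ≥ 5
  δ≥5 = v≤min⁺ 5≤n (All.map⁺ (All.map d≥5 (All.all-filter (_∈? V G) (allFin n))))
    where
    -- `n` is the default value of the minimum in `δ`, so it needs the bound too. A monochromatic
    -- triangle of the constant colouring provides a vertex `x`, whose degree lies between 5 and
    -- `n`.
    5≤n : 5 ≤ n
    5≤n = let x , _ , _ , xy , _ = proj₁ mr (record { colour = λ _ _ → true ; colour-symm = λ _ _ → refl })
          in  ≤-trans (d≥5 (inV G xy)) (∣p∣≤n (N G x))

  d≡5⇒≅ : ∀ v → v ∈ V G → d G v ≡ 5 →
          (G ⟨ v ⟩ ≅ N₅₋₁) ⊎ (G ⟨ v ⟩ ≅ N₅₋₂) ⊎ (G ⟨ v ⟩ ≅ N₅₋₃)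
  d≡5⇒≅ v v∈V d≡5 =
    conclude (neighbourhood-shape G mr v∈V ω≤4 (enumerate (N G v)) d≡5 (enumerate-surjective (N G v)))
    where
    module _ (π : Permutation 5 (d G v)) where

      y : Fin 5 → Fin n
      y = enumerate (N G v) ∘ (π ⟨$⟩ʳ_)

      y-injective : Injective _≡_ _≡_ y
      y-injective {i} {j} eq = trans (sym (inverseˡ π))
        (trans (cong (π ⟨$⟩ˡ_) (enumerate-injective (N G v) eq)) (inverseˡ π))

      y-covers : Covers y (V (G ⟨ v ⟩))
      y-covers u∈ =
        let i , eq = enumerate-surjective (N G v) (proj₂ (x∈p∩q⁻ (V G) (N G v) u∈)) in
        π ⟨$⟩ˡ i , trans (cong (enumerate (N G v)) (inverseʳ π)) eq

      iso : (K : Graph 5) → NoIsolated K →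
            Matches K (relabel y (adjMatrix (G ⟨ v ⟩))) → G ⟨ v ⟩ ≅ K
      iso K = matches⇒≅ (G ⟨ v ⟩) K y y-injective y-covers

    conclude : (∃ λ (π : Permutation 5 (d G v)) →
                  MatchesN₅ (relabel (y π) (adjMatrix (G ⟨ v ⟩)))) →
               (G ⟨ v ⟩ ≅ N₅₋₁) ⊎ (G ⟨ v ⟩ ≅ N₅₋₂) ⊎ (G ⟨ v ⟩ ≅ N₅₋₃)
    conclude (π , match) =
      Sum.map (iso π N₅₋₁ N₅₋₁-noIsolated)
        (Sum.map (iso π N₅₋₂ N₅₋₂-noIsolated) (iso π N₅₋₃ N₅₋₃-noIsolated)) match

theorem8p1 : ∀ {n : ℕ} (G : Graph n) → MinimalRamsey G → ω G ≤ 4 →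
    δ G ≥ 5 ×
    (∀ v → v ∈ V G → d G v ≡ 5 →
    (G ⟨ v ⟩ ≅ N₅₋₁) ⊎ (G ⟨ v ⟩ ≅ N₅₋₂) ⊎ (G ⟨ v ⟩ ≅ N₅₋₃))
theorem8p1 G mr ω≤4 = δ≥5 G mr ω≤4 , d≡5⇒≅ G mr ω≤4
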